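{- Let $m>2$ and $k$ be integers with $0<k<2^m$, and let $N=k\cdot 2^m+1$. Suppose that one of the following holds: (i) $k \equiv 1 \pmod{6}$, $k \equiv 1,7 \pmod{10}$ and $m \equiv 0 \pmod{4}$; (ii) $k \equiv 5 \pmod{6}$, $k \equiv 1,3 \pmod{10}$ and $m \equiv 1 \pmod{4}$; (iii) $k \equiv 1 \pmod{6}$, $k \equiv 3,9 \pmod{10}$ and $m \equiv 2 \pmod{4}$; (iv) $k \equiv 5 \pmod{6}$, $k \equiv 7,9 \pmod{10}$ and $m \equiv 3 \pmod{4}$. Let $x=V_k(8,1)$. Then $N$ is prime if and only if $N \mid S_{m-2}(x)$.
   Context: For $P,Q\in\mathbb{Z}$ the Lucas sequence $\{V_n(P,Q)\}$ is defined by $V_0(P,Q)=2$, $V_1(P,Q)=P$, $V_{n+1}(P,Q)=PV_n(P,Q)-QV_{n-1}(P,Q)$ for $n\ge 1$. For an integer $x$, the sequence $S_n(x)$ is defined by $S_0(x)=x$ and $S_{j+1}(x)=(S_j(x))^2-2$ for $j\ge 0$. -}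

module Defs where

open import Data.Nat using (ℕ; zero; suc)
open import Data.Integer using (ℤ; +_; _*_; _-_)

V : ℤ → ℤ → ℕ → ℤ
V P Q zero = + 2
V P Q (suc zero) = P
V P Q (suc (suc n)) = P * V P Q (suc n) - Q * V P Q n

S : ℕ → ℤ → ℤ
S zero x = x
S (suc j) x = S j x * S j x - + 2

{-# OPTIONS --safe #-}
-- Put α = 4 + √15 and β = 4 − √15, so that αβ = 1, V_k(8,1) = αᵏ + βᵏ and
-- S_j(V_k) = α^(k 2ʲ) + β^(k 2ʲ).  Hence a prime p divides S_{m−2}(V_k) iff
-- α^(k 2^(m−1)) = −1 in F_p[√15].
--
-- If N = 8c + 1 is prime, then (2/N) = 1 and (3/N) = (5/N) = −1: this follows from
-- raising the square roots 1 + i, 1 + 2ω and 1 + 2(ζ₅ + ζ₅⁻¹) of 2i, −3 and 5 to the N-th power.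
-- So u = 3 + √15 satisfies u^N = u, and u² = 6α gives α^(4c) = −1.
--
-- Conversely, let p be a prime factor of N ∣ S_{m−2}(V_k).  Frobenius gives αᵖ ∈ {α, β}, so the
-- order of α divides p − 1 or p + 1, while α^(k 2^(m−1)) = −1 makes it a multiple of 2ᵐ.
-- Thus p ≥ 2ᵐ − 1; equality would force k = 2ᵐ − 2, but k is odd.  So p ≥ 2ᵐ > √N.
module Submission where

open import Defs
open import Algebra.Bundles using (CommutativeRing; AbelianGroup)
open import Algebra.Morphism.Structures using (IsRingHomomorphism)
open import Data.Fin using (Fin; toℕ; fromℕ; inject₁) renaming (suc to fsuc)
open import Data.Fin.Properties using (toℕ-fromℕ; toℕ-inject₁; toℕ<n)
open import Data.Integer as ℤ using (ℤ; +_)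
import Data.Integer.Divisibility.Signed as ℤˢ
import Data.Integer.Properties as ℤ
open import Data.Integer.Tactic.RingSolver using (solve-∀)
open import Data.List using ([]; _∷_)
open import Data.List.Relation.Unary.All using (_∷_)
open import Data.Nat as ℕ using (ℕ; zero; suc; _∸_; _!; s≤s; z≤n)
open import Data.Nat.Combinatorics using (_C_; nCn≡1; k![n∸k]!∣n!)
open import Data.Nat.Combinatorics.Specification using (nCk≡n!/k![n-k]!)
import Data.Nat.Divisibility as ℕ
import Data.Nat.DivMod as ℕ
open import Data.Nat.ListAction using (product)
open import Data.Nat.Primality
open import Data.Nat.Primality.Factorisation using (factorise)
import Data.Nat.Properties as ℕ
import Data.Nat.Tactic.RingSolver as ℕSolver
open import Data.Product as Product using (_,_; proj₁; proj₂; ∃-syntax)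
open import Data.Sum as Sum using (_⊎_; inj₁; inj₂; [_,_]′)
open import Function.Base using (_∘_)
open import Relation.Binary.PropositionalEquality as ≡ using (_≡_)
open import Relation.Binary.Structures using (IsEquivalence)
open import Relation.Nullary using (¬_; contradiction)
import Algebra.Consequences.Setoid as Consequences
import Algebra.Construct.DirectProduct as DirectProduct
import Algebra.Properties.CommutativeSemiring.Binomial as Binomial
import Algebra.Properties.CommutativeSemiring.Exp as Exp
import Algebra.Properties.Ring as RingProperties
import Algebra.Properties.Semiring.Mult as Mult
import Algebra.Properties.Semiring.Sum as Sums
import Algebra.Solver.Ring.NaturalCoefficients.Default as NaturalSolver
import Relation.Binary.Reasoning.Setoid as SetoidReasoning

-- Ring-theoretic tools

prime∤1 : ∀ {p} → Prime p → ¬ (p ℕ.∣ 1)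
prime∤1 {p} p-prime p∣1 =
  contradiction (ℕ.∣1⇒≡1 p∣1) (ℕ.nonTrivial⇒≢1 {{prime⇒nonTrivial p-prime}})

prime∣k!⇒≤k : ∀ {p} → Prime p → ∀ k → p ℕ.∣ k ! → p ℕ.≤ k
prime∣k!⇒≤k p-prime zero p∣1 = contradiction p∣1 (prime∤1 p-prime)
prime∣k!⇒≤k p-prime (suc k) p∣ with euclidsLemma (suc k) (k !) p-prime p∣
... | inj₁ p∣1+k = ℕ.∣⇒≤ p∣1+k
... | inj₂ p∣k! = ℕ.m≤n⇒m≤1+n (prime∣k!⇒≤k p-prime k p∣k!)

-- `p` divides `p ! = (p C k) * (k ! * (p ∸ k) !)`, and neither factorial can absorb it, since both
-- arguments lie below `p`.
prime∣pCk : ∀ {p} → Prime p → ∀ {k} → 0 ℕ.< k → k ℕ.< p → p ℕ.∣ p C k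
prime∣pCk {p} p-prime {k} 0<k k<p
  with euclidsLemma (p C k) (k ! ℕ.* (p ∸ k) !) p-prime
         (≡.subst (p ℕ.∣_) (≡.sym pCk*k![p∸k]!≡p!) p∣p!)
  where
  instance _ = ℕ._!*_!≢0 k (p ∸ k)
  pCk*k![p∸k]!≡p! : (p C k) ℕ.* (k ! ℕ.* (p ∸ k) !) ≡ p !
  pCk*k![p∸k]!≡p! = ≡.trans (≡.cong (ℕ._* (k ! ℕ.* (p ∸ k) !)) (nCk≡n!/k![n-k]! (ℕ.<⇒≤ k<p)))
                            (ℕ.m/n*n≡m (k![n∸k]!∣n! (ℕ.<⇒≤ k<p)))
  p∣p! : p ℕ.∣ p !
  p∣p! = ≡.subst (λ n → n ℕ.∣ n !) (ℕ.suc-pred p {{prime⇒nonZero p-prime}})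
                 (ℕ.m∣m*n (ℕ.pred p !))
... | inj₁ p∣pCk = p∣pCk
... | inj₂ p∣k!*[p∸k]! with euclidsLemma (k !) ((p ∸ k) !) p-prime p∣k!*[p∸k]!
...   | inj₁ p∣k! = contradiction (prime∣k!⇒≤k p-prime k p∣k!) (ℕ.<⇒≱ k<p)
...   | inj₂ p∣[p∸k]! = contradiction (prime∣k!⇒≤k p-prime (p ∸ k) p∣[p∸k]!)
          (ℕ.<⇒≱ (ℕ.∸-monoʳ-< 0<k (ℕ.<⇒≤ k<p)))

module Frobenius {c ℓ} (R : CommutativeRing c ℓ) where
  open CommutativeRing R
  open Exp commutativeSemiring
  open Mult semiring
  open Sums semiring
  open SetoidReasoning setoid

  ^-oneˡ : ∀ n → 1# ^ n ≈ 1#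
  ^-oneˡ zero = refl
  ^-oneˡ (suc n) = trans (*-identityˡ _) (^-oneˡ n)

  module _ {p} (p-prime : Prime p) (p×1≈0 : p × 1# ≈ 0#) where

    ∣⇒×≈0 : ∀ {n} → p ℕ.∣ n → ∀ x → n × x ≈ 0#
    ∣⇒×≈0 (ℕ.divides-refl q) x = begin
      (q ℕ.* p) × x        ≈⟨ ×-congʳ (q ℕ.* p) (*-identityˡ x) ⟨
      (q ℕ.* p) × (1# * x) ≈⟨ ×-assoc-* (q ℕ.* p) 1# x ⟨
      (q ℕ.* p) × 1# * x   ≈⟨ *-congʳ (×1-homo-* q p) ⟩
      q × 1# * p × 1# * x  ≈⟨ *-congʳ (*-congˡ p×1≈0) ⟩
      q × 1# * 0# * x      ≈⟨ *-congʳ (zeroʳ _) ⟩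
      0# * x               ≈⟨ zeroˡ x ⟩
      0#                   ∎

    -- In the binomial expansion every coefficient except the two outer ones is a multiple of `p`,
    -- hence zero in characteristic `p`.
    frobenius-+ : ∀ x y → (x + y) ^ p ≈ x ^ p + y ^ p
    frobenius-+ x y = go p ≡.refl
      where
      module B = Binomial commutativeSemiring
      -- The copy `n` of `p` can be matched as a successor, which splits off the first and the last
      -- summand.
      go : ∀ n → p ≡ n → (x + y) ^ n ≈ x ^ n + y ^ n
      go zero ≡.refl = contradiction p-prime λ ()
      go (suc n) ≡.refl = begin
        (x + y) ^ p
          ≈⟨ B.theorem p x y ⟩
        sum (B.binomialTerm x y p)
          ≈⟨ sum-init-last (B.binomialTerm x y p) ⟩
        1 × (1# * y ^ p) + sum (λ i → B.binomialTerm x y p (inject₁ (fsuc i)))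
          + B.binomialTerm x y p (fromℕ p)
          ≈⟨ +-cong (+-cong (trans (+-identityʳ _) (*-identityˡ _))
                            (trans (sum-cong-≋ middle) (sum-replicate-zero n))) last ⟩
        y ^ p + 0# + x ^ p
          ≈⟨ +-congʳ (+-identityʳ _) ⟩
        y ^ p + x ^ p
          ≈⟨ +-comm _ _ ⟩
        x ^ p + y ^ p ∎
        where
        middle : ∀ (i : Fin n) → B.binomialTerm x y p (inject₁ (fsuc i)) ≈ 0#
        middle i = ∣⇒×≈0 (prime∣pCk p-prime (s≤s ℕ.z≤n)
          (≡.subst (ℕ._< p) (≡.sym (toℕ-inject₁ (fsuc i))) (s≤s (toℕ<n i)))) _
        last : B.binomialTerm x y p (fromℕ p) ≈ x ^ p
        last rewrite toℕ-fromℕ n | nCn≡1 p | ℕ.n∸n≡0 n =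
          trans (+-identityʳ _) (*-identityʳ _)

    -- Induction on `n`, with Frobenius applied to `1# + n × 1#`.
    fermat : ∀ n → (n × 1#) ^ p ≈ n × 1#
    fermat zero = go p p-prime
      where
      go : ∀ n → Prime n → 0# ^ n ≈ 0#
      go zero ()
      go (suc n) _ = zeroˡ _
    fermat (suc n) = trans (frobenius-+ 1# (n × 1#)) (+-cong (^-oneˡ p) (fermat n))

-- Powers of units and powers of two dividing their orders

even-or-odd : ∀ n → (∃[ t ] n ≡ t ℕ.* 2) ⊎ (∃[ t ] n ≡ 1 ℕ.+ t ℕ.* 2)
even-or-odd zero = inj₁ (0 , ≡.refl)
even-or-odd (suc n) with even-or-odd n
... | inj₁ (t , n≡) = inj₂ (t , ≡.cong suc n≡)
... | inj₂ (t , n≡) = inj₁ (suc t , ≡.cong suc n≡)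

-- An odd multiple of `k 2ʲ` is regrouped as a multiple of `n`, so that one power can be evaluated
-- in two ways in `2^∣annihilator`.
odd-multiple-exponent : ∀ k t {n i j} → i ℕ.≤ j → n ≡ (1 ℕ.+ t ℕ.* 2) ℕ.* 2 ℕ.^ i →
  k ℕ.* 2 ℕ.^ j ℕ.* (1 ℕ.+ t ℕ.* 2) ≡ n ℕ.* (k ℕ.* 2 ℕ.^ (j ∸ i))
odd-multiple-exponent k t {n} {i} {j} i≤j n≡q*2^i = begin
  k ℕ.* 2 ℕ.^ j ℕ.* q
    ≡⟨ ≡.cong (λ e → k ℕ.* 2 ℕ.^ e ℕ.* q) (ℕ.m+[n∸m]≡n i≤j) ⟨
  k ℕ.* 2 ℕ.^ (i ℕ.+ (j ∸ i)) ℕ.* q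
    ≡⟨ ≡.cong (λ e → k ℕ.* e ℕ.* q) (ℕ.^-distribˡ-+-* 2 i (j ∸ i)) ⟩
  k ℕ.* (2 ℕ.^ i ℕ.* 2 ℕ.^ (j ∸ i)) ℕ.* q
    ≡⟨ rearrange k (2 ℕ.^ i) (2 ℕ.^ (j ∸ i)) q ⟩
  q ℕ.* 2 ℕ.^ i ℕ.* (k ℕ.* 2 ℕ.^ (j ∸ i))
    ≡⟨ ≡.cong (ℕ._* (k ℕ.* 2 ℕ.^ (j ∸ i))) n≡q*2^i ⟨
  n ℕ.* (k ℕ.* 2 ℕ.^ (j ∸ i)) ∎
  where
  open ≡.≡-Reasoning
  q = 1 ℕ.+ t ℕ.* 2
  rearrange : ∀ k a b q → k ℕ.* (a ℕ.* b) ℕ.* q ≡ q ℕ.* a ℕ.* (k ℕ.* b)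
  rearrange = ℕSolver.solve-∀

module RingPowers {c ℓ} (R : CommutativeRing c ℓ) where
  open CommutativeRing R
  open Exp commutativeSemiring
  open Frobenius R using (^-oneˡ)
  open RingProperties ring using (-1*x≈-x; -‿involutive)
  open NaturalSolver commutativeSemiring using (solve; _:=_; _:+_; _:*_)
  open SetoidReasoning setoid

  ^-period : ∀ x n → x ^ n ≈ 1# → ∀ r q → x ^ (r ℕ.+ q ℕ.* n) ≈ x ^ r
  ^-period x n xⁿ≈1 r q = begin
    x ^ (r ℕ.+ q ℕ.* n)     ≈⟨ ^-homo-* x r (q ℕ.* n) ⟩
    x ^ r * x ^ (q ℕ.* n)   ≈⟨ *-congˡ (^-congʳ x (ℕ.*-comm q n)) ⟩
    x ^ r * x ^ (n ℕ.* q)   ≈⟨ *-congˡ (^-assocʳ x n q) ⟨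
    x ^ r * (x ^ n) ^ q     ≈⟨ *-congˡ (^-congˡ q xⁿ≈1) ⟩
    x ^ r * 1# ^ q          ≈⟨ *-congˡ (^-oneˡ q) ⟩
    x ^ r * 1#              ≈⟨ *-identityʳ _ ⟩
    x ^ r                   ∎

  ^-double : ∀ x n → x ^ (2 ℕ.* n) ≈ x ^ n * x ^ n
  ^-double x n = trans (^-homo-* x n (n ℕ.+ 0)) (*-congˡ (^-congʳ x (ℕ.+-identityʳ n)))

  -- Turns the subtraction-free semiring identities behind `lucas-step` and `squares-step` into
  -- differences.
  x+y≈z⇒x≈z-y : ∀ {x y z} → x + y ≈ z → x ≈ z - y
  x+y≈z⇒x≈z-y {x} {y} {z} x+y≈z = begin
    x              ≈⟨ +-identityʳ x ⟨
    x + 0#         ≈⟨ +-congˡ (-‿inverseʳ y) ⟨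
    x + (y - y)    ≈⟨ +-assoc x y (- y) ⟨
    x + y - y      ≈⟨ +-congʳ x+y≈z ⟩
    z - y          ∎

  x+y≈0⇒x≈-y : ∀ {x y} → x + y ≈ 0# → x ≈ - y
  x+y≈0⇒x≈-y x+y≈0 = trans (x+y≈z⇒x≈z-y x+y≈0) (+-identityˡ _)

  -- With `X = xⁿ` and `Y = yⁿ` this is the Lucas recurrence for power sums of the roots of t² - (x
  -- + y)t + xy.
  lucas-step : ∀ x y X Y → x * (x * X) + y * (y * Y) ≈ (x + y) * (x * X + y * Y) - x * y * (X + Y)
  lucas-step x y X Y = x+y≈z⇒x≈z-y (solve 4 (λ x y X Y →
    (x :* (x :* X) :+ y :* (y :* Y) :+ x :* y :* (X :+ Y)) := ((x :+ y) :* (x :* X :+ y :* Y))) refl x y X Y)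

  -- For `x * y ≈ 1#` the subtracted term is 2, which gives the recurrence of `S`.
  squares-step : ∀ x y → x * x + y * y ≈ (x + y) * (x + y) - (x * y + x * y)
  squares-step x y = x+y≈z⇒x≈z-y (solve 2 (λ x y →
    (x :* x :+ y :* y :+ (x :* y :+ x :* y)) := ((x :+ y) :* (x :+ y))) refl x y)

  module _ {x y} (xy≈1 : x * y ≈ 1#) where

    *-cancel-unit : ∀ {z w} → x * z ≈ x * w → z ≈ w
    *-cancel-unit {z} {w} xz≈xw = begin
      z             ≈⟨ insert z ⟩
      y * (x * z)   ≈⟨ *-congˡ xz≈xw ⟩
      y * (x * w)   ≈⟨ insert w ⟨
      w             ∎
      where
      insert : ∀ z → z ≈ y * (x * z)
      insert z = trans (sym (*-identityˡ z))
        (trans (*-congʳ (trans (sym xy≈1) (*-comm x y))) (*-assoc y x z))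

    inverse-^ : ∀ n → x ^ n * y ^ n ≈ 1#
    inverse-^ n = trans (sym (^-distrib-* x y n)) (trans (^-congˡ n xy≈1) (^-oneˡ n))

    x+x⁻¹≈0⇒x²≈-1 : x + y ≈ 0# → x * x ≈ - 1#
    x+x⁻¹≈0⇒x²≈-1 x+y≈0 = x+y≈0⇒x≈-y (begin
      x * x + 1#     ≈⟨ +-congˡ xy≈1 ⟨
      x * x + x * y  ≈⟨ distribˡ x x y ⟨
      x * (x + y)    ≈⟨ *-congˡ x+y≈0 ⟩
      x * 0#         ≈⟨ zeroʳ x ⟩
      0#             ∎)

    x²≈-1⇒x+x⁻¹≈0 : x * x ≈ - 1# → x + y ≈ 0#
    x²≈-1⇒x+x⁻¹≈0 x²≈-1 = begin
      x + y                ≈⟨ *-identityˡ _ ⟨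
      1# * (x + y)         ≈⟨ *-congʳ xy≈1 ⟨
      x * y * (x + y)      ≈⟨ solve 2 (λ x y → (x :* y :* (x :+ y)) := (y :* (x :* x :+ x :* y))) refl x y ⟩
      y * (x * x + x * y)  ≈⟨ *-congˡ (+-cong x²≈-1 xy≈1) ⟩
      y * (- 1# + 1#)      ≈⟨ *-congˡ (-‿inverseˡ 1#) ⟩
      y * 0#               ≈⟨ zeroʳ y ⟩
      0#                   ∎

  [-1]²≈1 : (- 1#) ^ 2 ≈ 1#
  [-1]²≈1 = trans (*-congˡ (*-identityʳ _)) (trans (-1*x≈-x (- 1#)) (-‿involutive 1#))

  -- If n = 2ⁱ q with q odd and i ≤ j, then x^(k 2ʲ q) is both (−1)^q and a power of xⁿ.
  2^∣annihilator : ∀ {x n j} k → ¬ (- 1# ≈ 1#) → x ^ n ≈ 1# → x ^ (k ℕ.* 2 ℕ.^ j) ≈ - 1# →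
             ∀ i → i ℕ.≤ suc j → 2 ℕ.^ i ℕ.∣ n
  2^∣annihilator k -1≉1 xⁿ≈1 x^≈-1 zero _ = ℕ.1∣ _
  2^∣annihilator {x} {n} {j} k -1≉1 xⁿ≈1 x^≈-1 (suc i) (ℕ.s≤s i≤j)
    with 2^∣annihilator {x} {n} {j} k -1≉1 xⁿ≈1 x^≈-1 i (ℕ.m≤n⇒m≤1+n i≤j)
  ... | ℕ.divides q n≡q*2^i with even-or-odd q
  ...   | inj₁ (t , ≡.refl) = ℕ.divides t (≡.trans n≡q*2^i (ℕ.*-assoc t 2 (2 ℕ.^ i)))
  ...   | inj₂ (t , ≡.refl) = contradiction -1≈1 -1≉1
    where
    e = k ℕ.* 2 ℕ.^ j
    f = k ℕ.* 2 ℕ.^ (j ∸ i)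
    -1≈1 : - 1# ≈ 1#
    -1≈1 = begin
      - 1#                        ≈⟨ *-identityʳ _ ⟨
      (- 1#) ^ 1                  ≈⟨ ^-period (- 1#) 2 [-1]²≈1 1 t ⟨
      (- 1#) ^ (1 ℕ.+ t ℕ.* 2)    ≈⟨ ^-congˡ (1 ℕ.+ t ℕ.* 2) x^≈-1 ⟨
      (x ^ e) ^ (1 ℕ.+ t ℕ.* 2)   ≈⟨ ^-assocʳ x e (1 ℕ.+ t ℕ.* 2) ⟩
      x ^ (e ℕ.* (1 ℕ.+ t ℕ.* 2)) ≡⟨ ≡.cong (x ^_) (odd-multiple-exponent k t i≤j n≡q*2^i) ⟩
      x ^ (n ℕ.* f)               ≈⟨ ^-assocʳ x n f ⟨
      (x ^ n) ^ f                 ≈⟨ ^-congˡ f xⁿ≈1 ⟩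
      1# ^ f                      ≈⟨ ^-oneˡ f ⟩
      1#                          ∎

  -- Since `y` is the inverse of `x`, either x^(p - 1) = 1 or x^(p + 1) = 1, so `2 ^ suc j` divides
  -- p - 1 or p + 1. Writing p - 1 as `suc h * 2` keeps it nonzero, so divisibility bounds the size.
  2^[1+j]≤1+p : ∀ {x y p h} → ¬ (- 1# ≈ 1#) → x * y ≈ 1# → p ≡ 1 ℕ.+ suc h ℕ.* 2 →
    x ^ p ≈ x ⊎ x ^ p ≈ y → ∀ k j → x ^ (k ℕ.* 2 ℕ.^ j) ≈ - 1# → 2 ℕ.^ suc j ℕ.≤ suc p
  2^[1+j]≤1+p {x} {y} {p} {h} -1≉1 xy≈1 ≡.refl (inj₁ xᵖ≈x) k j x^≈-1 =
    ℕ.≤-trans (ℕ.∣⇒≤ (2^∣annihilator {n = suc h ℕ.* 2} k -1≉1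
                (*-cancel-unit xy≈1 (trans xᵖ≈x (sym (*-identityʳ x)))) x^≈-1 (suc j) ℕ.≤-refl))
              (ℕ.m≤n+m (suc h ℕ.* 2) 2)
  2^[1+j]≤1+p {x} {y} {p} {h} -1≉1 xy≈1 ≡.refl (inj₂ xᵖ≈y) k j x^≈-1 =
    ℕ.∣⇒≤ (2^∣annihilator {n = 2 ℕ.+ suc h ℕ.* 2} k -1≉1 (trans (*-congˡ xᵖ≈y) xy≈1) x^≈-1 (suc j) ℕ.≤-refl)

  -- Expanding u · (u⁸)ᶜ gives u^(1 + 8c) = -x^(4c) u, so (x^(4c) + 1) u = 0. Multiplying by `v`
  -- replaces `u` by `w`; in the application `v` is the conjugate of `u`, and `w` is a scalar that
  -- can be cancelled.
  x^[4c]+1-annihilated : ∀ {x u v w d c} → u * v ≈ w → u ^ 8 ≈ d * x ^ 4 → d ^ c ≈ - 1# →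
    u ^ (1 ℕ.+ c ℕ.* 8) ≈ u → w * (x ^ (c ℕ.* 4) + 1#) ≈ 0#
  x^[4c]+1-annihilated {x} {u} {v} {w} {d} {c} uv≈w u⁸≈ dᶜ≈-1 u^≈u = begin
    w * (X + 1#)                        ≈⟨ *-congʳ uv≈w ⟨
    u * v * (X + 1#)                    ≈⟨ solve 3 (λ u v s → (u :* v :* s) := (v :* (s :* u))) refl u v (X + 1#) ⟩
    v * ((X + 1#) * u)                  ≈⟨ *-congˡ (distribʳ u X 1#) ⟩
    v * (X * u + 1# * u)                ≈⟨ *-congˡ (+-congˡ (trans (*-identityˡ u) (trans (sym u^≈u) u^≈-Xu))) ⟩
    v * (X * u + - 1# * (X * u))        ≈⟨ *-congˡ (trans (+-congˡ (-1*x≈-x (X * u))) (-‿inverseʳ (X * u))) ⟩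
    v * 0#                              ≈⟨ zeroʳ v ⟩
    0#                                  ∎
    where
    X = x ^ (c ℕ.* 4)
    u^≈-Xu : u ^ (1 ℕ.+ c ℕ.* 8) ≈ - 1# * (X * u)
    u^≈-Xu = begin
      u * u ^ (c ℕ.* 8)               ≡⟨ ≡.cong (λ n → u * u ^ n) (ℕ.*-comm c 8) ⟩
      u * u ^ (8 ℕ.* c)               ≈⟨ *-congˡ (^-assocʳ u 8 c) ⟨
      u * (u ^ 8) ^ c                 ≈⟨ *-congˡ (^-congˡ c u⁸≈) ⟩
      u * (d * x ^ 4) ^ c             ≈⟨ *-congˡ (^-distrib-* d (x ^ 4) c) ⟩
      u * (d ^ c * (x ^ 4) ^ c)       ≈⟨ *-congˡ (*-cong dᶜ≈-1 (^-assocʳ x 4 c)) ⟩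
      u * (- 1# * x ^ (4 ℕ.* c))      ≡⟨ ≡.cong (λ n → u * (- 1# * x ^ n)) (ℕ.*-comm 4 c) ⟩
      u * (- 1# * X)                  ≈⟨ solve 3 (λ u v s → (u :* (v :* s)) := (v :* (s :* u))) refl u (- 1#) X ⟩
      - 1# * (X * u)                  ∎

-- R[t] / (t² = r + s t), with a + b t encoded as (a , b).
module QuadraticExtension {c ℓ} (R : CommutativeRing c ℓ) (r s : CommutativeRing.Carrier R) where
  open CommutativeRing R
  open NaturalSolver commutativeSemiring using (solve; _:=_; _:+_; _:*_)
  private
    module Additive = AbelianGroup (DirectProduct.abelianGroup +-abelianGroup +-abelianGroup)

  infixl 7 _·_
  _·_ : Carrier Product.× Carrier → Carrier Product.× Carrier → Carrier Product.× Carrier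
  (a , b) · (c , d) = a * c + r * (b * d) , a * d + b * c + s * (b * d)

  ·-cong : ∀ {x x′ y y′} → x Additive.≈ x′ → y Additive.≈ y′ → x · y Additive.≈ x′ · y′
  ·-cong (a≈ , b≈) (c≈ , d≈) =
    +-cong (*-cong a≈ c≈) (*-congˡ (*-cong b≈ d≈)) ,
    +-cong (+-cong (*-cong a≈ d≈) (*-cong b≈ c≈)) (*-congˡ (*-cong b≈ d≈))

  ·-assoc : ∀ x y z → (x · y) · z Additive.≈ x · (y · z)
  ·-assoc (a , b) (c , d) (e , f) =
    solve 8 (λ r s a b c d e f →
      ((a :* c :+ r :* (b :* d)) :* e :+ r :* ((a :* d :+ b :* c :+ s :* (b :* d)) :* f))
      := (a :* (c :* e :+ r :* (d :* f)) :+ r :* (b :* (c :* f :+ d :* e :+ s :* (d :* f)))))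
      refl r s a b c d e f ,
    solve 8 (λ r s a b c d e f →
      ((a :* c :+ r :* (b :* d)) :* f :+ (a :* d :+ b :* c :+ s :* (b :* d)) :* e
        :+ s :* ((a :* d :+ b :* c :+ s :* (b :* d)) :* f))
      := (a :* (c :* f :+ d :* e :+ s :* (d :* f)) :+ b :* (c :* e :+ r :* (d :* f))
        :+ s :* (b :* (c :* f :+ d :* e :+ s :* (d :* f)))))
      refl r s a b c d e f

  ·-comm : ∀ x y → x · y Additive.≈ y · x
  ·-comm (a , b) (c , d) =
    solve 5 (λ r a b c d → (a :* c :+ r :* (b :* d)) := (c :* a :+ r :* (d :* b))) refl r a b c d ,
    solve 5 (λ s a b c d → (a :* d :+ b :* c :+ s :* (b :* d)) := (c :* b :+ d :* a :+ s :* (d :* b)))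
      refl s a b c d

  ·-distribˡ : ∀ x y z → x · (y Additive.∙ z) Additive.≈ (x · y) Additive.∙ (x · z)
  ·-distribˡ (a , b) (c , d) (e , f) =
    solve 7 (λ r a b c d e f → (a :* (c :+ e) :+ r :* (b :* (d :+ f)))
      := ((a :* c :+ r :* (b :* d)) :+ (a :* e :+ r :* (b :* f))))
      refl r a b c d e f ,
    solve 7 (λ s a b c d e f → (a :* (d :+ f) :+ b :* (c :+ e) :+ s :* (b :* (d :+ f)))
      := ((a :* d :+ b :* c :+ s :* (b :* d)) :+ (a :* f :+ b :* e :+ s :* (b :* f))))
      refl s a b c d e f

  ι : Carrier → Carrier Product.× Carrier
  ι a = a , 0#

  y+r0≈y : ∀ {y z} t x → y ≈ z → y + t * (0# * x) ≈ z
  y+r0≈y t x y≈z =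
    trans (+-cong y≈z (trans (*-congˡ (zeroˡ x)) (zeroʳ t))) (+-identityʳ _)

  ι-· : ∀ a c d → ι a · (c , d) Additive.≈ (a * c , a * d)
  ι-· a c d = y+r0≈y r d refl , y+r0≈y s d (trans (+-congˡ (zeroˡ c)) (+-identityʳ _))

  ·-identityˡ : ∀ x → ι 1# · x Additive.≈ x
  ·-identityˡ (a , b) = Additive.trans (ι-· 1# a b) (*-identityˡ a , *-identityˡ b)

  quadraticExtension : CommutativeRing c ℓ
  quadraticExtension = record
    { Carrier = Carrier Product.× Carrier
    ; _≈_ = Additive._≈_
    ; _+_ = Additive._∙_
    ; _*_ = _·_
    ; -_ = Additive._⁻¹
    ; 0# = ι 0#
    ; 1# = ι 1#
    ; isCommutativeRing = record
      { isRing = record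
        { +-isAbelianGroup = Additive.isAbelianGroup
        ; *-cong = ·-cong
        ; *-assoc = ·-assoc
        ; *-identity = Consequences.comm∧idˡ⇒id Additive.setoid ·-comm ·-identityˡ
        ; distrib = Consequences.comm∧distrˡ⇒distr Additive.setoid Additive.∙-cong ·-comm ·-distribˡ
        }
      ; *-comm = ·-comm
      }
    }

  private
    module Q = CommutativeRing quadraticExtension
    module MultR = Mult semiring
    module MultQ = Mult Q.semiring
    module ExpR = Exp commutativeSemiring
    module ExpQ = Exp Q.commutativeSemiring

  ι-* : ∀ a b → ι a · ι b Q.≈ ι (a * b)
  ι-* a b = Q.trans (ι-· a b 0#) (refl , zeroʳ a)

  ι-^ : ∀ a n → ι a ExpQ.^ n Q.≈ ι (a ExpR.^ n)
  ι-^ a zero = Q.refl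
  ι-^ a (suc n) = Q.trans (Q.*-congˡ (ι-^ a n)) (ι-* a (a ExpR.^ n))

  ×-componentwise : ∀ n a b → n MultQ.× (a , b) ≡ (n MultR.× a , n MultR.× b)
  ×-componentwise zero a b = ≡.refl
  ×-componentwise (suc n) a b = ≡.cong ((a , b) Additive.∙_) (×-componentwise n a b)

  -- The extension inherits characteristic `p`, so Frobenius applies there too, and again in a tower
  -- of extensions.
  ×1≈0-lift : ∀ n → n MultR.× 1# ≈ 0# → n MultQ.× Q.1# Q.≈ Q.0#
  ×1≈0-lift n n×1≈0 = Q.trans (Q.reflexive (×-componentwise n 1# 0#))
    (n×1≈0 , n×0≈0 n)
    where
    n×0≈0 : ∀ n → n MultR.× 0# ≈ 0#
    n×0≈0 zero = refl
    n×0≈0 (suc n) = trans (+-identityˡ _) (n×0≈0 n)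

module QuadraticPowers {c ℓ} (R : CommutativeRing c ℓ) (r s : CommutativeRing.Carrier R) where
  open QuadraticExtension R r s
  open CommutativeRing quadraticExtension
  open Exp commutativeSemiring
  open SetoidReasoning setoid
  private
    module R = CommutativeRing R
    module ExpR = Exp R.commutativeSemiring

  -- Once some power of an element is a scalar `d`, its p-th power is a scalar multiple of it.
  -- Comparing components with the Frobenius value then determines `d ^ q`.
  scalar-power : ∀ {a b d} n → (a , b) ^ n ≈ ι d → ∀ q →
    (a , b) ^ (1 ℕ.+ q ℕ.* n) ≈ (d ExpR.^ q R.* a , d ExpR.^ q R.* b)
  scalar-power {a} {b} {d} n xⁿ≈d q = begin
    (a , b) ^ (1 ℕ.+ q ℕ.* n)       ≡⟨ ≡.cong (λ e → (a , b) ^ suc e) (ℕ.*-comm q n) ⟩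
    (a , b) * (a , b) ^ (n ℕ.* q)   ≈⟨ *-congˡ (^-assocʳ (a , b) n q) ⟨
    (a , b) * ((a , b) ^ n) ^ q     ≈⟨ *-congˡ (^-congˡ q xⁿ≈d) ⟩
    (a , b) * ι d ^ q               ≈⟨ *-congˡ (ι-^ d q) ⟩
    (a , b) * ι (d ExpR.^ q)        ≈⟨ *-comm _ _ ⟩
    ι (d ExpR.^ q) * (a , b)        ≈⟨ ι-· _ a b ⟩
    (d ExpR.^ q R.* a , d ExpR.^ q R.* b) ∎

-- Lucas sequences and the iterates `S` as power sums

module LucasSequences {c ℓ} (R : CommutativeRing c ℓ) {ι : ℤ → CommutativeRing.Carrier R}
  (ι-homo : IsRingHomomorphism ℤ.+-*-rawRing (CommutativeRing.rawRing R) ι) where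
  open CommutativeRing R
  open Exp commutativeSemiring
  open RingPowers R
  open IsRingHomomorphism ι-homo
  open SetoidReasoning setoid

  ι-minus : ∀ a b → ι (a ℤ.- b) ≈ ι a - ι b
  ι-minus a b = trans (+-homo a (ℤ.- b)) (+-congˡ (-‿homo b))

  -- Binet's formula for the roots `x`, `y` of t² - Pt + Q.
  ι-V : ∀ {P Q x y} → ι P ≈ x + y → ι Q ≈ x * y → ∀ n → ι (V P Q n) ≈ x ^ n + y ^ n
  ι-V P≈ Q≈ zero = trans (+-homo (+ 1) (+ 1)) (+-cong 1#-homo 1#-homo)
  ι-V P≈ Q≈ (suc zero) = trans P≈ (sym (+-cong (*-identityʳ _) (*-identityʳ _)))
  ι-V {P} {Q} {x} {y} P≈ Q≈ (suc (suc n)) = begin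
    ι (P ℤ.* V₁ ℤ.- Q ℤ.* V₀)        ≈⟨ ι-minus (P ℤ.* V₁) (Q ℤ.* V₀) ⟩
    ι (P ℤ.* V₁) - ι (Q ℤ.* V₀)      ≈⟨ +-cong (*-homo P V₁) (-‿cong (*-homo Q V₀)) ⟩
    ι P * ι V₁ - ι Q * ι V₀
      ≈⟨ +-cong (*-cong P≈ (ι-V P≈ Q≈ (suc n))) (-‿cong (*-cong Q≈ (ι-V P≈ Q≈ n))) ⟩
    (x + y) * (x * x ^ n + y * y ^ n) - x * y * (x ^ n + y ^ n)
      ≈⟨ lucas-step x y (x ^ n) (y ^ n) ⟨
    x ^ suc (suc n) + y ^ suc (suc n)    ∎
    where
    V₀ = V P Q n
    V₁ = V P Q (suc n)

  -- For inverse `x` and `y`, squaring the sum and subtracting 2 doubles the exponent.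
  ι-S : ∀ {s x y} → x * y ≈ 1# → ι s ≈ x + y → ∀ j → ι (S j s) ≈ x ^ (2 ℕ.^ j) + y ^ (2 ℕ.^ j)
  ι-S xy≈1 s≈x+y zero = trans s≈x+y (sym (+-cong (*-identityʳ _) (*-identityʳ _)))
  ι-S {s} {x} {y} xy≈1 s≈x+y (suc j) = begin
    ι (S j s ℤ.* S j s ℤ.- + 2)
      ≈⟨ ι-minus (S j s ℤ.* S j s) (+ 2) ⟩
    ι (S j s ℤ.* S j s) - ι (+ 2)
      -- The constant 2 becomes `X * Y + X * Y`, since `X` and `Y` are inverse to each other.
      ≈⟨ +-cong (*-homo (S j s) (S j s)) (-‿cong (trans (+-homo (+ 1) (+ 1)) (+-cong ι1≈XY ι1≈XY))) ⟩
    ι (S j s) * ι (S j s) - (X * Y + X * Y)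
      ≈⟨ +-congʳ (*-cong IH IH) ⟩
    (X + Y) * (X + Y) - (X * Y + X * Y)
      ≈⟨ squares-step X Y ⟨
    X * X + Y * Y
      ≈⟨ +-cong (^-double x (2 ℕ.^ j)) (^-double y (2 ℕ.^ j)) ⟨
    x ^ (2 ℕ.^ suc j) + y ^ (2 ℕ.^ suc j) ∎
    where
    X = x ^ (2 ℕ.^ j)
    Y = y ^ (2 ℕ.^ j)
    ι1≈XY = trans 1#-homo (sym (inverse-^ xy≈1 (2 ℕ.^ j)))
    IH = ι-S xy≈1 s≈x+y j

  module _ {P x y} (P≈x+y : ι P ≈ x + y) (xy≈1 : x * y ≈ 1#) (k j : ℕ) where
    private
      X = (x ^ k) ^ (2 ℕ.^ j)
      Y = (y ^ k) ^ (2 ℕ.^ j)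
      xᵏyᵏ≈1 = inverse-^ xy≈1 k

      ι-S∘V : ι (S j (V P (+ 1) k)) ≈ X + Y
      ι-S∘V = ι-S xᵏyᵏ≈1 (ι-V P≈x+y (trans 1#-homo (sym xy≈1)) k) j

      X²≈ : X * X ≈ x ^ (k ℕ.* 2 ℕ.^ suc j)
      X²≈ = trans (sym (^-double (x ^ k) (2 ℕ.^ j))) (^-assocʳ x k (2 ℕ.^ suc j))

    -- As `Y` is the inverse of `X`, the sum `X + Y` vanishes exactly when X² = -1. Squaring
    -- accounts for the exponent `suc j` in place of `j`.
    S∘V≈0⇒^≈-1 : ι (S j (V P (+ 1) k)) ≈ 0# → x ^ (k ℕ.* 2 ℕ.^ suc j) ≈ - 1#
    S∘V≈0⇒^≈-1 S≈0 =
      trans (sym X²≈) (x+x⁻¹≈0⇒x²≈-1 (inverse-^ xᵏyᵏ≈1 (2 ℕ.^ j)) (trans (sym ι-S∘V) S≈0))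

    ^≈-1⇒S∘V≈0 : x ^ (k ℕ.* 2 ℕ.^ suc j) ≈ - 1# → ι (S j (V P (+ 1) k)) ≈ 0#
    ^≈-1⇒S∘V≈0 x^≈-1 =
      trans ι-S∘V (x²≈-1⇒x+x⁻¹≈0 (inverse-^ xᵏyᵏ≈1 (2 ℕ.^ j)) (trans X²≈ x^≈-1))

-- Arithmetic modulo a prime

-- The ring ℤ/p is ℤ with congruence modulo p as its equality.
module Modular (p : ℕ) where
  infix 4 _≋_
  -- A record rather than a bare divisibility, so that `a` and `b` can be recovered from the type.
  record _≋_ (a b : ℤ) : Set where
    constructor mod
    field ∣- : + p ℤˢ.∣ a ℤ.- b
  open _≋_ public

  private
    ∣-resp : ∀ {a b} → a ≡ b → + p ℤˢ.∣ a → + p ℤˢ.∣ b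
    ∣-resp = ≡.subst (+ p ℤˢ.∣_)

  ≋-isEquivalence : IsEquivalence _≋_
  ≋-isEquivalence = record
    { refl = λ {a} → mod (∣-resp (≡.sym (ℤ.+-inverseʳ a)) (ℤˢ.divides (+ 0) ≡.refl))
    ; sym = λ {a} {b} (mod d) → mod (∣-resp (neg a b) (ℤˢ.∣m⇒∣-m d))
    ; trans = λ {a} {b} {c} (mod d) (mod e) → mod (∣-resp (tele a b c) (ℤˢ.∣m∣n⇒∣m+n d e))
    }
    where
    neg : ∀ a b → ℤ.- (a ℤ.- b) ≡ b ℤ.- a
    neg = solve-∀
    tele : ∀ a b c → (a ℤ.- b) ℤ.+ (b ℤ.- c) ≡ a ℤ.- c
    tele = solve-∀

  open IsEquivalence ≋-isEquivalence public
    using () renaming (reflexive to ≋-reflexive)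

  ℤ/ : CommutativeRing _ _
  ℤ/ = record
    { Carrier = ℤ
    ; _≈_ = _≋_
    ; _+_ = ℤ._+_
    ; _*_ = ℤ._*_
    ; -_ = ℤ.-_
    ; 0# = + 0
    ; 1# = + 1
    ; isCommutativeRing = record
      { isRing = record
        { +-isAbelianGroup = record
          { isGroup = record
            { isMonoid = record
              { isSemigroup = record
                { isMagma = record
                  { isEquivalence = ≋-isEquivalence
                  ; ∙-cong = λ {a} {b} {c} {d} (mod e) (mod f) →
                      mod (∣-resp (+-diff a b c d) (ℤˢ.∣m∣n⇒∣m+n e f))
                  }
                ; assoc = λ a b c → ≋-reflexive (ℤ.+-assoc a b c)
                }
              ; identity = (λ a → ≋-reflexive (ℤ.+-identityˡ a)) , λ a → ≋-reflexive (ℤ.+-identityʳ a)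
              }
            ; inverse = (λ a → ≋-reflexive (ℤ.+-inverseˡ a)) , λ a → ≋-reflexive (ℤ.+-inverseʳ a)
            ; ⁻¹-cong = λ {a} {b} (mod d) → mod (∣-resp (neg-diff a b) (ℤˢ.∣m⇒∣-m d))
            }
          ; comm = λ a b → ≋-reflexive (ℤ.+-comm a b)
          }
        ; *-cong = λ {a} {b} {c} {d} (mod e) (mod f) →
            mod (∣-resp (*-diff a b c d) (ℤˢ.∣m∣n⇒∣m+n (ℤˢ.∣n⇒∣m*n a f) (ℤˢ.∣n⇒∣m*n d e)))
        ; *-assoc = λ a b c → ≋-reflexive (ℤ.*-assoc a b c)
        ; *-identity = (λ a → ≋-reflexive (ℤ.*-identityˡ a)) , λ a → ≋-reflexive (ℤ.*-identityʳ a)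
        ; distrib = (λ a b c → ≋-reflexive (ℤ.*-distribˡ-+ a b c)) , λ a b c → ≋-reflexive (ℤ.*-distribʳ-+ a b c)
        }
      ; *-comm = λ a b → ≋-reflexive (ℤ.*-comm a b)
      }
    }
    where
    +-diff : ∀ a b c d → (a ℤ.- b) ℤ.+ (c ℤ.- d) ≡ (a ℤ.+ c) ℤ.- (b ℤ.+ d)
    +-diff = solve-∀
    neg-diff : ∀ a b → ℤ.- (a ℤ.- b) ≡ ℤ.- a ℤ.- ℤ.- b
    neg-diff = solve-∀
    *-diff : ∀ a b c d → a ℤ.* (c ℤ.- d) ℤ.+ d ℤ.* (a ℤ.- b) ≡ a ℤ.* c ℤ.- b ℤ.* d
    *-diff = solve-∀

  open CommutativeRing ℤ/ using (semiring; 1#)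
  open Mult semiring using (_×_)

  ∣⇒≋0 : ∀ {a} → + p ℤˢ.∣ a → a ≋ + 0
  ∣⇒≋0 {a} d = mod (∣-resp (≡.sym (ℤ.+-identityʳ a)) d)

  ≋0⇒∣ : ∀ {a} → a ≋ + 0 → + p ℤˢ.∣ a
  ≋0⇒∣ {a} (mod d) = ∣-resp (ℤ.+-identityʳ a) d

  ×1≡+ : ∀ n → n × 1# ≡ + n
  ×1≡+ zero = ≡.refl
  ×1≡+ (suc n) = ≡.cong (ℤ.suc) (×1≡+ n)

  characteristic : p × 1# ≋ + 0
  characteristic = ∣⇒≋0 (ℤˢ.∣-reflexive (≡.sym (×1≡+ p)))

  integral : Prime p → ∀ a b → a ℤ.* b ≋ + 0 → a ≋ + 0 ⊎ b ≋ + 0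
  integral p-prime a b ab≈0
    with euclidsLemma ℤ.∣ a ∣ ℤ.∣ b ∣ p-prime
      (≡.subst (p ℕ.∣_) (ℤ.abs-* a b) (ℤˢ.∣⇒∣ᵤ (≋0⇒∣ ab≈0)))
  ... | inj₁ d = inj₁ (∣⇒≋0 (ℤˢ.∣ᵤ⇒∣ d))
  ... | inj₂ d = inj₂ (∣⇒≋0 (ℤˢ.∣ᵤ⇒∣ d))

module PrimeField {p} (p-prime : Prime p) where
  open Modular p
  module F = CommutativeRing ℤ/
  open Exp F.commutativeSemiring

  fermat-ℕ : ∀ n → (+ n) ^ p ≋ + n
  fermat-ℕ n = ≡.subst (λ a → a ^ p ≋ a) (×1≡+ n) (Frobenius.fermat ℤ/ p-prime characteristic n)

  square-root-of-1 : ∀ t → t ℤ.* t ≋ + 1 → t ≋ + 1 ⊎ t ≋ ℤ.- + 1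
  square-root-of-1 t t²≋1 = Sum.map
    (RingProperties.x∙y⁻¹≈ε⇒x≈y F.ring t (+ 1))
    (RingPowers.x+y≈0⇒x≈-y ℤ/ {t} {+ 1})
    (integral p-prime (t ℤ.- + 1) (t ℤ.+ + 1)
       (F.trans (F.reflexive (factor t)) (RingProperties.x≈y⇒x∙y⁻¹≈ε F.ring t²≋1)))
    where
    factor : ∀ t → (t ℤ.- + 1) ℤ.* (t ℤ.+ + 1) ≡ t ℤ.* t ℤ.- + 1
    factor = solve-∀

  *-cancelˡ : ∀ a b c → ¬ (a ≋ + 0) → a ℤ.* b ≋ a ℤ.* c → b ≋ c
  *-cancelˡ a b c a≢0 ab≋ac = [ (λ a≋0 → contradiction a≋0 a≢0) , RingProperties.x∙y⁻¹≈ε⇒x≈y F.ring b c ]′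
    (integral p-prime a (b ℤ.- c) (F.trans (F.reflexive (factor a b c))
      (RingProperties.x≈y⇒x∙y⁻¹≈ε F.ring ab≋ac)))
    where
    factor : ∀ a b c → a ℤ.* (b ℤ.- c) ≡ a ℤ.* b ℤ.- a ℤ.* c
    factor = solve-∀

  -- Fermat gives n t² = nᵖ = n for t = nʰ, so t² = 1 after cancelling `n`.
  euler-±1 : ∀ h → p ≡ 1 ℕ.+ h ℕ.* 2 → ∀ n → ¬ (+ n ≋ + 0) → (+ n) ^ h ≋ + 1 ⊎ (+ n) ^ h ≋ ℤ.- + 1
  euler-±1 h p≡1+h*2 n n≢0 = square-root-of-1 t (*-cancelˡ (+ n) (t ℤ.* t) (+ 1) n≢0 n*t²≋n)
    where
    t = (+ n) ^ h
    n*t²≋n : + n ℤ.* (t ℤ.* t) ≋ + n ℤ.* + 1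
    n*t²≋n = F.trans (F.*-congˡ {+ n} (F.trans (F.*-congˡ {t} (F.sym (F.*-identityʳ t))) (^-assocʳ (+ n) h 2)))
      (F.trans (^-congʳ (+ n) (≡.sym p≡1+h*2)) (F.trans (fermat-ℕ n) (F.sym (F.*-identityʳ (+ n)))))

-- Euler's criterion for 2, −3 and 5: as (p − 1)/2 = 4c, the fourth powers 16, 81 and 625 appear.
module EulerCriteria {p c} (p-prime : Prime p) (p≡1+c*8 : p ≡ 1 ℕ.+ c ℕ.* 8) where
  open Modular p
  open CommutativeRing ℤ/ using (commutativeSemiring; *-identityʳ)
  open Exp commutativeSemiring using (_^_)
  module F = CommutativeRing ℤ/

  -- (1 + i)⁸ = 16, so (1 + i)ᵖ = 16ᶜ(1 + i). Frobenius gives 1 + iᵖ = 1 + i, because p ≡ 1 modulo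
  -- 8, and the first components are compared.
  16^c≋1 : (+ 16) ^ c ≋ + 1
  16^c≋1 = F.trans (F.sym (*-identityʳ _)) (proj₁ (begin
    (+ 16) ^ c F.* + 1 , (+ 16) ^ c F.* + 1  ≈⟨ scalar-power 8 Q.refl c ⟨
    (Q.1# Q.+ i) E.^ (1 ℕ.+ c ℕ.* 8)         ≡⟨ ≡.cong ((Q.1# Q.+ i) E.^_) p≡1+c*8 ⟨
    (Q.1# Q.+ i) E.^ p                       ≈⟨ frobenius-+ p-prime (×1≈0-lift p characteristic) Q.1# i ⟩
    Q.1# E.^ p Q.+ i E.^ p                   ≡⟨ ≡.cong (λ n → Q.1# E.^ p Q.+ i E.^ n) p≡1+c*8 ⟩
    Q.1# E.^ p Q.+ i E.^ (1 ℕ.+ c ℕ.* 8)     ≈⟨ Q.+-cong (^-oneˡ p) (^-period i 8 Q.refl 1 c) ⟩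
    (+ 1 , + 1)                              ∎))
    where
    open QuadraticExtension ℤ/ (ℤ.- + 1) (+ 0)
    open QuadraticPowers ℤ/ (ℤ.- + 1) (+ 0)
    module Q = CommutativeRing quadraticExtension
    module E = Exp Q.commutativeSemiring
    open Frobenius quadraticExtension
    open RingPowers quadraticExtension
    open SetoidReasoning Q.setoid
    i = (+ 0 , + 1)

  -- The relation ω² = -1 - ω makes ω a cube root of unity, and w = 1 + 2ω has w² = -3, hence w⁸ =
  -- 81. As p ≡ 2 modulo 3, Frobenius sends ω to ω², and therefore w to -w.
  81^c≋-1 : ∀ {e} → p ≡ 2 ℕ.+ e ℕ.* 3 → (+ 81) ^ c ≋ ℤ.- + 1
  81^c≋-1 {e} p≡2+e*3 = F.trans (F.sym (*-identityʳ _)) (proj₁ (begin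
    (+ 81) ^ c F.* + 1 , (+ 81) ^ c F.* + 2  ≈⟨ scalar-power 8 Q.refl c ⟨
    w E.^ (1 ℕ.+ c ℕ.* 8)                     ≡⟨ ≡.cong (w E.^_) p≡1+c*8 ⟨
    (Q.1# Q.+ (ω Q.+ ω)) E.^ p                ≈⟨ frob Q.1# (ω Q.+ ω) ⟩
    Q.1# E.^ p Q.+ (ω Q.+ ω) E.^ p            ≈⟨ Q.+-congˡ {Q.1# E.^ p} (frob ω ω) ⟩
    Q.1# E.^ p Q.+ (ω E.^ p Q.+ ω E.^ p)      ≡⟨ ≡.cong (λ n → Q.1# E.^ p Q.+ (ω E.^ n Q.+ ω E.^ n)) p≡2+e*3 ⟩
    Q.1# E.^ p Q.+ (ω E.^ (2 ℕ.+ e ℕ.* 3) Q.+ ω E.^ (2 ℕ.+ e ℕ.* 3))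
      ≈⟨ Q.+-cong (^-oneˡ p) (Q.+-cong ω^p≈ω² ω^p≈ω²) ⟩
    (ℤ.- + 1 , ℤ.- + 2)                       ∎))
    where
    open QuadraticExtension ℤ/ (ℤ.- + 1) (ℤ.- + 1)
    open QuadraticPowers ℤ/ (ℤ.- + 1) (ℤ.- + 1)
    module Q = CommutativeRing quadraticExtension
    module E = Exp Q.commutativeSemiring
    open Frobenius quadraticExtension
    open RingPowers quadraticExtension
    open SetoidReasoning Q.setoid
    frob = frobenius-+ p-prime (×1≈0-lift p characteristic)
    ω = (+ 0 , + 1)
    w = Q.1# Q.+ (ω Q.+ ω)
    ω^p≈ω² = ^-period ω 3 Q.refl 2 e

  -- w = 1 + 2η has w² = 5, hence w⁸ = 625. For p ≡ ±2 modulo 5, Frobenius sends η = ζ + ζ⁴ to the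
  -- conjugate ζ² + ζ³ = -1 - η, and therefore w to -w.
  625^c≋-1 : ∀ {f} → p ≡ 2 ℕ.+ f ℕ.* 5 ⊎ p ≡ 3 ℕ.+ f ℕ.* 5 → (+ 625) ^ c ≋ ℤ.- + 1
  625^c≋-1 {f} p≡±2 = F.trans (F.sym (*-identityʳ _)) (proj₁
    (Q.trans (Q.sym (scalar-power 8 Q.refl c)) (proj₁ (begin
      ι (w₀ E₀.^ (1 ℕ.+ c ℕ.* 8))          ≈⟨ ι-^ w₀ (1 ℕ.+ c ℕ.* 8) ⟨
      w E.^ (1 ℕ.+ c ℕ.* 8)                ≡⟨ ≡.cong (w E.^_) p≡1+c*8 ⟨
      w E.^ p                              ≈⟨ frob K.1# (η K.+ η) ⟩
      K.1# E.^ p K.+ (η K.+ η) E.^ p       ≈⟨ K.+-cong (^-oneˡ p) (frob η η) ⟩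
      K.1# K.+ (η E.^ p K.+ η E.^ p)       ≈⟨ K.+-congˡ {K.1#} (K.+-cong η^p η^p) ⟩
      -- The omitted term evaluates to -w; the outer projections compare its rational component with
      -- that of 625ᶜ w.
      _                                    ∎))))
    where
    module Q = CommutativeRing (QuadraticExtension.quadraticExtension ℤ/ (+ 1) (ℤ.- + 1))
    module E₀ = Exp Q.commutativeSemiring
    open QuadraticPowers ℤ/ (+ 1) (ℤ.- + 1)
    open QuadraticExtension (QuadraticExtension.quadraticExtension ℤ/ (+ 1) (ℤ.- + 1)) (Q.- Q.1#) (+ 0 , + 1)
    module K = CommutativeRing quadraticExtension
    module E = Exp K.commutativeSemiring
    open Frobenius quadraticExtension
    open RingPowers quadraticExtension
    open SetoidReasoning K.setoid
    frob = frobenius-+ p-prime (×1≈0-lift p (QuadraticExtension.×1≈0-lift ℤ/ (+ 1) (ℤ.- + 1) p characteristic))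
    -- The lower extension adjoins η = ζ + ζ⁻¹, a root of η² = 1 − η; then ζ² = ηζ − 1.
    ζ ζ⁴ η w : K.Carrier
    ζ = (Q.0# , Q.1#)
    ζ⁴ = ζ E.^ 4
    η = ζ K.+ ζ⁴
    w₀ : Q.Carrier
    w₀ = (+ 1 , + 2)
    w = K.1# K.+ (η K.+ η)
    η^p : η E.^ p K.≈ ζ E.^ 2 K.+ ζ E.^ 3
    η^p = K.trans (frob ζ ζ⁴) ([ case-2 , case-3 ]′ p≡±2)
      where
      case-2 : p ≡ 2 ℕ.+ f ℕ.* 5 → ζ E.^ p K.+ ζ⁴ E.^ p K.≈ ζ E.^ 2 K.+ ζ E.^ 3
      case-2 ≡.refl = K.+-cong (^-period ζ 5 K.refl 2 f) (^-period ζ⁴ 5 K.refl 2 f)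
      case-3 : p ≡ 3 ℕ.+ f ℕ.* 5 → ζ E.^ p K.+ ζ⁴ E.^ p K.≈ ζ E.^ 2 K.+ ζ E.^ 3
      case-3 ≡.refl = K.trans (K.+-cong (^-period ζ 5 K.refl 3 f) (^-period ζ⁴ 5 K.refl 3 f))
        (K.+-comm (ζ E.^ 3) (ζ E.^ 2))

-- Frobenius and the element α in ℤ/p[√15]

module ℤ[√15] {p} (p-prime : Prime p) where
  open Modular p public
  open QuadraticExtension ℤ/ (+ 15) (+ 0) using (quadraticExtension; ι; ι-*; ι-·; ι-^; ×1≈0-lift) public
  open CommutativeRing quadraticExtension
  open Exp commutativeSemiring
  open Frobenius quadraticExtension
  open QuadraticPowers ℤ/ (+ 15) (+ 0)
  open Mult semiring using (_×_)
  open SetoidReasoning setoid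
  private
    module F = CommutativeRing ℤ/
    module F^ = Exp F.commutativeSemiring

  √15 α β : Carrier
  √15 = (+ 0 , + 1)
  α = (+ 4 , + 1)
  β = (+ 4 , ℤ.- + 1)

  ι-isRingHomomorphism : IsRingHomomorphism ℤ.+-*-rawRing rawRing ι
  ι-isRingHomomorphism = record
    { isSemiringHomomorphism = record
      { isNearSemiringHomomorphism = record
        { +-isMonoidHomomorphism = record
          { isMagmaHomomorphism = record
            { isRelHomomorphism = record { cong = λ a≡b → F.reflexive a≡b , F.refl }
            ; homo = λ a b → F.refl , F.refl }
          ; ε-homo = F.refl , F.refl }
        ; *-homo = λ a b → sym {ι a * ι b} {ι (a ℤ.* b)} (ι-* a b) }
      ; 1#-homo = F.refl , F.refl }
    ; -‿homo = λ a → F.refl , F.refl }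

  -- Frobenius fixes the scalar `n` by Fermat and multiplies √15 by `a ^ q`. It is used with d = 2,
  -- a = 15 for α, and with d = 8, a = 15⁴ for 3 + √15.
  [n+√15]^p : ∀ n d q {a} → p ≡ 1 ℕ.+ q ℕ.* d → √15 ^ d ≈ ι a →
    (n × 1# + √15) ^ p ≈ n × 1# + (+ 0 , a F^.^ q)
  [n+√15]^p n d q {a} p≡1+q*d √15ᵈ≈a = begin
    (n × 1# + √15) ^ p                  ≈⟨ frobenius-+ p-prime char (n × 1#) √15 ⟩
    (n × 1#) ^ p + √15 ^ p
      ≈⟨ +-cong {(n × 1#) ^ p} {n × 1#} (fermat p-prime char n) (^-congʳ √15 p≡1+q*d) ⟩
    n × 1# + √15 ^ (1 ℕ.+ q ℕ.* d)      ≈⟨ +-congˡ {n × 1#} (scalar-power d √15ᵈ≈a q) ⟩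
    n × 1# + (t ℤ.* + 0 , t ℤ.* + 1)
      ≈⟨ +-congˡ {n × 1#} {(t ℤ.* + 0 , t ℤ.* + 1)} {(+ 0 , t)} (F.zeroʳ t , F.*-identityʳ t) ⟩
    n × 1# + (+ 0 , t)                  ∎
    where
    t = a F^.^ q
    char = ×1≈0-lift p characteristic

module _ {p} (p-prime : Prime p) where
  open ℤ[√15] p-prime
  open CommutativeRing quadraticExtension
  open Exp commutativeSemiring
  open RingPowers quadraticExtension
  open LucasSequences quadraticExtension ι-isRingHomomorphism
  open PrimeField p-prime using (euler-±1; *-cancelˡ)
  open SetoidReasoning setoid
  private
    module F = CommutativeRing ℤ/
    module F^ = Exp F.commutativeSemiring

  -- The p-th power keeps 4 and multiplies √15 by 15^((p - 1)/2), which is ±1.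
  α^p≈α⊎β : ∀ {h} → p ≡ 1 ℕ.+ h ℕ.* 2 → ¬ (+ 15 ≋ + 0) → α ^ p ≈ α ⊎ α ^ p ≈ β
  α^p≈α⊎β {h} p≡1+h*2 15≢0 = Sum.map α^p≈ α^p≈ (euler-±1 h p≡1+h*2 15 15≢0)
    where
    α^p≈ : ∀ {a} → (+ 15) F^.^ h ≋ a → α ^ p ≈ (+ 4 , + 0 ℤ.+ a)
    α^p≈ {a} t≋a = trans {α ^ p} {(+ 4 , + 0 ℤ.+ ((+ 15) F^.^ h))} {(+ 4 , + 0 ℤ.+ a)}
      ([n+√15]^p 4 2 h {+ 15} p≡1+h*2 refl) (F.refl , F.+-congˡ {+ 0} t≋a)

  -- The vanishing gives α^(k 2^(1 + j)) = -1; the order bound adds one more factor 2.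
  S∘V≋0⇒2^≤1+p : ∀ {h} → p ≡ 1 ℕ.+ suc h ℕ.* 2 → ¬ (+ 15 ≋ + 0) → ¬ (ℤ.- + 1 ≋ + 1) →
    ∀ k j → S j (V (+ 8) (+ 1) k) ≋ + 0 → 2 ℕ.^ (2 ℕ.+ j) ℕ.≤ suc p
  S∘V≋0⇒2^≤1+p {h} p≡1+h*2 15≢0 -1≢1 k j S≋0 =
    2^[1+j]≤1+p {α} {β} {p} {h} (-1≢1 ∘ proj₁) refl p≡1+h*2 (α^p≈α⊎β {suc h} p≡1+h*2 15≢0) k (suc j)
      (S∘V≈0⇒^≈-1 {+ 8} {α} {β} refl refl k j (S≋0 , F.refl))

  -- If 15 is a square modulo `p`, the ring has zero divisors; nonzero scalars still cancel,
  -- componentwise.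
  scalar-cancel : ∀ {s x} → ¬ (s ≋ + 0) → ι s * x ≈ 0# → x ≈ 0#
  scalar-cancel {s} {a , b} s≢0 sx≈0 =
    *-cancelˡ s a (+ 0) s≢0 (F.trans (proj₁ sa,sb≈0) (F.sym (F.zeroʳ s))) ,
    *-cancelˡ s b (+ 0) s≢0 (F.trans (proj₂ sa,sb≈0) (F.sym (F.zeroʳ s)))
    where
    sa,sb≈0 : (s ℤ.* a , s ℤ.* b) ≈ 0#
    sa,sb≈0 = trans {(s ℤ.* a , s ℤ.* b)} {ι s * (a , b)} {0#}
      (sym {ι s * (a , b)} {(s ℤ.* a , s ℤ.* b)} (ι-· s a b)) sx≈0

  -- The element u = 3 + √15 satisfies u⁸ = 1296 α⁴ and has norm −6.
  S∘V≋0 : ∀ {c} → p ≡ 1 ℕ.+ c ℕ.* 8 →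
    (+ 16) F^.^ c ≋ + 1 → (+ 81) F^.^ c ≋ ℤ.- + 1 → (+ 625) F^.^ c ≋ ℤ.- + 1 → ¬ (ℤ.- + 6 ≋ + 0) →
    ∀ k j → k ℕ.* 2 ℕ.^ suc j ≡ c ℕ.* 4 → S j (V (+ 8) (+ 1) k) ≋ + 0
  S∘V≋0 {c} p≡1+c*8 16ᶜ≋1 81ᶜ≋-1 625ᶜ≋-1 -6≢0 k j k*2^[1+j]≡c*4 =
    proj₁ (^≈-1⇒S∘V≈0 {+ 8} {α} {β} refl refl k j
      (trans {α ^ (k ℕ.* 2 ℕ.^ suc j)} {α ^ (c ℕ.* 4)} { - 1# } (^-congʳ α k*2^[1+j]≡c*4)
        (x+y≈0⇒x≈-y {α ^ (c ℕ.* 4)} {1#}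
          (scalar-cancel { ℤ.- + 6 } {α ^ (c ℕ.* 4) + 1#} -6≢0
            (x^[4c]+1-annihilated {α} {u} {+ 3 , ℤ.- + 1} {ι (ℤ.- + 6)} {ι (+ 1296)} {c}
              refl refl 1296ᶜ≈-1 u^≈u)))))
    where
    u : Carrier
    u = + 3 , + 1
    -- 50625 = 15⁴ = 81 · 625: the two signs -1 cancel, so Frobenius fixes √15 and with it `u`.
    50625ᶜ≋1 : (+ 50625) F^.^ c ≋ + 1
    50625ᶜ≋1 = F.trans (F^.^-distrib-* (+ 81) (+ 625) c) (F.*-cong {x = (+ 81) F^.^ c} 81ᶜ≋-1 625ᶜ≋-1)
    -- 1296 = 6⁴ = 16 · 81, where only the factor 81 contributes a sign.
    1296ᶜ≈-1 : ι (+ 1296) ^ c ≈ - 1#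
    1296ᶜ≈-1 = trans {ι (+ 1296) ^ c} {ι ((+ 1296) F^.^ c)} { - 1# } (ι-^ (+ 1296) c)
      (F.trans (F^.^-distrib-* (+ 16) (+ 81) c) (F.*-cong {x = (+ 16) F^.^ c} 16ᶜ≋1 81ᶜ≋-1) , F.refl)
    u^≈u : u ^ (1 ℕ.+ c ℕ.* 8) ≈ u
    u^≈u = begin
      u ^ (1 ℕ.+ c ℕ.* 8)                      ≡⟨ ≡.cong (u ^_) p≡1+c*8 ⟨
      u ^ p                                    ≈⟨ [n+√15]^p 3 8 c {+ 50625} p≡1+c*8 refl ⟩
      (+ 3 , + 0 ℤ.+ ((+ 50625) F^.^ c))       ≈⟨ F.refl , F.+-congˡ {+ 0} 50625ᶜ≋1 ⟩
      u                                        ∎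

-- Residues and prime factors of k 2ᵐ + 1

open import Data.Nat using (_+_; _*_; _^_; _<_; _≤_; _%_; _/_)
open import Data.Nat using (NonZero; NonTrivial; nonTrivial⇒nonZero; nonTrivial⇒≢1; nonTrivial⇒n>1; n>1⇒nonTrivial)
open import Data.Nat.DivMod
open import Data.Integer.Divisibility using (_∣_)
open import Data.Product using (_×_)
open import Function.Bundles using (_⇔_; mk⇔)
open import Relation.Binary.PropositionalEquality using (refl; trans; sym; cong; cong₂; subst)

^-%≡1 : ∀ b d .{{_ : NonZero d}} → b % d ≡ 1 % d → ∀ q → b ^ q % d ≡ 1 % d
^-%≡1 b d b%d≡1 zero = refl
^-%≡1 b d b%d≡1 (suc q) = trans (%-distribˡ-* b (b ^ q) d)
  (trans (cong₂ (λ x y → (x * y) % d) b%d≡1 (^-%≡1 b d b%d≡1 q)) (sym (%-distribˡ-* 1 1 d)))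

-- Since 2⁴ = 16 is 1 modulo `d`, only `m % 4` matters. The moduli used are 3 and 5.
2^m%d : ∀ m d .{{_ : NonZero d}} → 16 % d ≡ 1 % d → 2 ^ m % d ≡ 2 ^ (m % 4) % d
2^m%d m d 16%d≡1 = begin
  2 ^ m % d                            ≡⟨ cong (λ n → 2 ^ n % d) m≡r+4q ⟩
  2 ^ (r + 4 * q) % d                  ≡⟨ cong (_% d) (ℕ.^-distribˡ-+-* 2 r (4 * q)) ⟩
  (2 ^ r * 2 ^ (4 * q)) % d            ≡⟨ cong (λ x → (2 ^ r * x) % d) (ℕ.^-*-assoc 2 4 q) ⟨
  (2 ^ r * 16 ^ q) % d                 ≡⟨ %-distribˡ-* (2 ^ r) _ d ⟩
  (2 ^ r % d * (16 ^ q % d)) % d       ≡⟨ cong (λ x → (2 ^ r % d * x) % d) (^-%≡1 16 d 16%d≡1 q) ⟩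
  (2 ^ r % d * (1 % d)) % d            ≡⟨ %-distribˡ-* (2 ^ r) 1 d ⟨
  (2 ^ r * 1) % d                      ≡⟨ cong (_% d) (ℕ.*-identityʳ (2 ^ r)) ⟩
  2 ^ r % d                            ∎
  where
  open ≡.≡-Reasoning
  r = m % 4
  q = m / 4
  m≡r+4q : m ≡ r + 4 * q
  m≡r+4q = trans (m≡m%n+[m/n]*n m 4) (cong (λ x → r + x) (ℕ.*-comm q 4))

[k2^m+1]%d : ∀ k m d e .{{_ : NonZero d}} .{{_ : NonZero e}} → d ℕ.∣ e → 16 % d ≡ 1 % d →
  (k * 2 ^ m + 1) % d ≡ (k % e * 2 ^ (m % 4) + 1) % d
[k2^m+1]%d k m d e d∣e 16%d≡1 = begin
  (k * 2 ^ m + 1) % d                                ≡⟨ %-distribˡ-+ (k * 2 ^ m) 1 d ⟩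
  ((k * 2 ^ m) % d + 1 % d) % d                      ≡⟨ cong (λ x → (x + 1 % d) % d) k2^m%d ⟩
  ((k % e * 2 ^ (m % 4)) % d + 1 % d) % d            ≡⟨ %-distribˡ-+ (k % e * 2 ^ (m % 4)) 1 d ⟨
  (k % e * 2 ^ (m % 4) + 1) % d                      ∎
  where
  open ≡.≡-Reasoning
  k2^m%d : (k * 2 ^ m) % d ≡ (k % e * 2 ^ (m % 4)) % d
  k2^m%d = trans (%-distribˡ-* k (2 ^ m) d) (trans
    (cong₂ (λ x y → (x * y) % d) (sym (m∣n⇒o%n%m≡o%m d e k d∣e)) (2^m%d m d 16%d≡1))
    (sym (%-distribˡ-* (k % e) (2 ^ (m % 4)) d)))

module _ (m k : ℕ) where
  private
    N = k * 2 ^ m + 1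

    N%3 : ∀ {a b} → k % 6 ≡ a → m % 4 ≡ b → N % 3 ≡ (a * 2 ^ b + 1) % 3
    N%3 refl refl = [k2^m+1]%d k m 3 6 (ℕ.divides 2 refl) refl

    N%5 : ∀ {a b} → k % 10 ≡ a → m % 4 ≡ b → N % 5 ≡ (a * 2 ^ b + 1) % 5
    N%5 refl refl = [k2^m+1]%d k m 5 10 (ℕ.divides 2 refl) refl

    k%2 : ∀ {a} → k % 6 ≡ a → k % 2 ≡ a % 2
    k%2 refl = sym (m∣n⇒o%n%m≡o%m 2 6 k (ℕ.divides 3 refl))

  -- The four cases enter the proof only through these facts: `k` is odd, and `N` is a quadratic
  -- nonresidue modulo 3 and modulo 5. After reduction each case is a numerical evaluation.
  residues :
    ((k % 6 ≡ 1 × (k % 10 ≡ 1 ⊎ k % 10 ≡ 7) × m % 4 ≡ 0)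
     ⊎ (k % 6 ≡ 5 × (k % 10 ≡ 1 ⊎ k % 10 ≡ 3) × m % 4 ≡ 1)
     ⊎ (k % 6 ≡ 1 × (k % 10 ≡ 3 ⊎ k % 10 ≡ 9) × m % 4 ≡ 2)
     ⊎ (k % 6 ≡ 5 × (k % 10 ≡ 7 ⊎ k % 10 ≡ 9) × m % 4 ≡ 3)) →
    k % 2 ≡ 1 × N % 3 ≡ 2 × (N % 5 ≡ 2 ⊎ N % 5 ≡ 3)
  residues (inj₁ (k6 , k10 , m4)) =
    k%2 k6 , N%3 k6 m4 , Sum.map (λ e → N%5 e m4) (λ e → N%5 e m4) k10
  residues (inj₂ (inj₁ (k6 , k10 , m4))) =
    -- Here the first alternative for `k` gives the residue 3 modulo 5 and the second gives 2, hence
    -- the swap.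
    k%2 k6 , N%3 k6 m4 , Sum.swap (Sum.map (λ e → N%5 e m4) (λ e → N%5 e m4) k10)
  residues (inj₂ (inj₂ (inj₁ (k6 , k10 , m4)))) =
    k%2 k6 , N%3 k6 m4 , Sum.swap (Sum.map (λ e → N%5 e m4) (λ e → N%5 e m4) k10)
  residues (inj₂ (inj₂ (inj₂ (k6 , k10 , m4)))) =
    k%2 k6 , N%3 k6 m4 , Sum.map (λ e → N%5 e m4) (λ e → N%5 e m4) k10

prime-factor : ∀ d .{{_ : NonZero d}} → ¬ (d ≡ 1) → ∃[ p ] Prime p × p ℕ.∣ d
prime-factor d d≢1 with factorise d
... | record { factors = [] ; isFactorisation = d≡1 } = contradiction d≡1 d≢1
... | record { factors = p ∷ ps ; isFactorisation = d≡ ; factorsPrime = p-prime ∷ _ } =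
  p , p-prime , subst (p ℕ.∣_) (sym d≡) (ℕ.m∣m*n (product ps))

-- A nontrivial divisor below `M` would have a prime factor below `M`, so prime factors suffice for
-- roughness.
no-small-prime-factor⇒prime : ∀ n M .{{_ : NonTrivial n}} → n < M * M →
  (∀ p → Prime p → p ℕ.∣ n → M ≤ p) → Prime n
no-small-prime-factor⇒prime n M n<M² M≤ = rough∧square>⇒prime {n} {M} rough n<M²
  where
  rough : M Rough n
  rough (ℕ.hasNonTrivialDivisor {d} {{d-nonTrivial}} d<M d∣n) =
    let instance d≢0 = nonTrivial⇒nonZero d {{d-nonTrivial}}
        p , p-prime , p∣d = prime-factor d (nonTrivial⇒≢1 {{d-nonTrivial}})
    in ℕ.<⇒≱ d<M (ℕ.≤-trans (M≤ p p-prime (ℕ.∣-trans p∣d d∣n)) (ℕ.∣⇒≤ p∣d))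

-- If 2^(1 + m) = p + 1, then N = kp + (k + 1), so `p` divides k + 1 ≤ p + 1. As p ≥ 2, this forces
-- k + 1 = p; then 2^(1 + m) = k + 2 makes `k` even.
2^m≤1+p⇒2^m≤p : ∀ {p k m} → k % 2 ≡ 1 → 2 ≤ p → k < 2 ^ suc m → p ℕ.∣ k * 2 ^ suc m + 1 →
  2 ^ suc m ≤ suc p → 2 ^ suc m ≤ p
2^m≤1+p⇒2^m≤p {p} {k} {m} k%2≡1 2≤p k<M p∣N M≤1+p with ℕ.m≤n⇒m<n∨m≡n M≤1+p
... | inj₁ (s≤s M≤p) = M≤p
... | inj₂ M≡1+p
  with ℕ.∣m+n∣m⇒∣n
    (subst (p ℕ.∣_) (trans (cong (λ M → k * M + 1) M≡1+p) (rearrange k p)) p∣N) (ℕ.n∣m*n k)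
  where
  rearrange : ∀ k p → k * suc p + 1 ≡ k * p + suc k
  rearrange = ℕSolver.solve-∀
...   | ℕ.divides 1 1+k≡p = contradiction (trans (sym k%2≡1) (ℕ.n∣m⇒m%n≡0 k 2 2∣k)) λ ()
  where
  2∣k : 2 ℕ.∣ k
  2∣k = ℕ.∣m+n∣m⇒∣n {m = 2} (subst (2 ℕ.∣_) 2^[1+m]≡2+k (ℕ.m∣m*n (2 ^ m))) ℕ.∣-refl
    where
    2^[1+m]≡2+k : 2 ^ suc m ≡ 2 + k
    2^[1+m]≡2+k = trans M≡1+p (cong suc (sym (trans 1+k≡p (ℕ.*-identityˡ p))))
...   | ℕ.divides (suc (suc q)) 1+k≡ = contradiction (ℕ.+-cancelʳ-≤ p p 1 (begin
    p + p              ≤⟨ ℕ.+-monoʳ-≤ p (ℕ.m≤m+n p (q * p)) ⟩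
    p + (p + q * p)    ≡⟨ 1+k≡ ⟨
    suc k              ≤⟨ k<M ⟩
    2 ^ suc m          ≡⟨ M≡1+p ⟩
    1 + p              ∎)) (ℕ.<⇒≱ 2≤p)
  where open ℕ.≤-Reasoning

k*M+1<M*M : ∀ {k M} → k < M → 1 < M → k * M + 1 < M * M
k*M+1<M*M {k} {M} k<M 1<M = begin-strict
  k * M + 1    <⟨ ℕ.+-monoʳ-< (k * M) 1<M ⟩
  k * M + M    ≡⟨ ℕ.+-comm (k * M) M ⟩
  suc k * M    ≤⟨ ℕ.*-monoˡ-≤ M k<M ⟩
  M * M        ∎
  where open ℕ.≤-Reasoning

module _ {p} (p-prime : Prime p) where
  open Modular p

  ≋0⇒∣ᵤ : ∀ {a} → a ≋ + 0 → p ℕ.∣ ℤ.∣ a ∣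
  ≋0⇒∣ᵤ = ℤˢ.∣⇒∣ᵤ ∘ ≋0⇒∣

  -- If `p` divides 3 or 5, it also divides the residue of `n` there; Euclidean reduction of that
  -- pair ends at 1.
  prime∤15 : ∀ {n} → p ℕ.∣ n → n % 3 ≡ 2 → n % 5 ≡ 2 ⊎ n % 5 ≡ 3 → ¬ (p ℕ.∣ 15)
  prime∤15 {n} p∣n n%3≡2 n%5≡±2 p∣15 = prime∤1 p-prime
    ([ (λ p∣3 → reduce {3} p∣3 (p∣residue {3} n%3≡2 p∣3))
     , (λ p∣5 → [ (λ n%5≡2 → reduce {5} p∣5 (p∣residue {5} n%5≡2 p∣5))
                , (λ n%5≡3 → 3-case p∣5 (p∣residue {5} n%5≡3 p∣5))
                ]′ n%5≡±2)
     ]′ (euclidsLemma 3 5 p-prime p∣15))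
    where
    reduce : ∀ {a b} .{{_ : NonZero b}} → p ℕ.∣ a → p ℕ.∣ b → p ℕ.∣ a % b
    reduce = ℕ.%-presˡ-∣
    3-case : p ℕ.∣ 5 → p ℕ.∣ 3 → p ℕ.∣ 1
    3-case p∣5 p∣3 = reduce {3} p∣3 (reduce {5} p∣5 p∣3)
    p∣residue : ∀ {d r} .{{_ : NonZero d}} → n % d ≡ r → p ℕ.∣ d → p ℕ.∣ r
    p∣residue refl p∣d = reduce p∣n p∣d

  prime∤2 : ∀ {n c} → p ℕ.∣ n → n ≡ 1 + c * 8 → ¬ (p ℕ.∣ 2)
  prime∤2 {c = c} p∣n refl p∣2 =
    prime∤1 p-prime (ℕ.∣m+n∣m⇒∣n (subst (p ℕ.∣_) (ℕ.+-comm 1 (c * 8)) p∣n)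
                                 (ℕ.∣n⇒∣m*n c (ℕ.∣-trans p∣2 (ℕ.divides 4 refl))))

  -- The successor records p ≥ 3, the form that the order bound needs.
  odd-prime : ¬ (p ℕ.∣ 2) → ∃[ h ] p ≡ 1 + suc h * 2
  odd-prime p∤2 with even-or-odd p
  ... | inj₁ (t , p≡t*2) with prime⇒irreducible p-prime (ℕ.divides t p≡t*2)
  ...   | inj₂ refl = contradiction ℕ.∣-refl p∤2
  odd-prime p∤2 | inj₂ (zero , refl) = contradiction p-prime ¬prime[1]
  odd-prime p∤2 | inj₂ (suc h , p≡) = h , p≡

-- The primality criterion for k 2ᵐ + 1

theorem3p4 : (m k : ℕ) → 2 < m → 0 < k → k < 2 ^ m →
    ((k % 6 ≡ 1 × (k % 10 ≡ 1 ⊎ k % 10 ≡ 7) × m % 4 ≡ 0)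
    ⊎ (k % 6 ≡ 5 × (k % 10 ≡ 1 ⊎ k % 10 ≡ 3) × m % 4 ≡ 1)
    ⊎ (k % 6 ≡ 1 × (k % 10 ≡ 3 ⊎ k % 10 ≡ 9) × m % 4 ≡ 2)
    ⊎ (k % 6 ≡ 5 × (k % 10 ≡ 7 ⊎ k % 10 ≡ 9) × m % 4 ≡ 3)) →
    Prime (k * 2 ^ m + 1) ⇔ (+ (k * 2 ^ m + 1) ∣ S (m ∸ 2) (V (+ 8) (+ 1) k))
theorem3p4 (suc zero) _ (s≤s ())
theorem3p4 (suc (suc zero)) _ (s≤s (s≤s ()))
theorem3p4 m@(suc (suc (suc j))) k _ 0<k k<2^m hyp = mk⇔ to from
  where
  N = k * 2 ^ m + 1
  -- With m = 3 + j this is (N - 1)/8, so 4c = (N - 1)/2 is the exponent k 2^(m - 1) at which α must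
  -- equal -1. The index `m ∸ 2` is `suc j`.
  c = k * 2 ^ j
  N≡1+c*8 : N ≡ 1 + c * 8
  N≡1+c*8 = rearrange k (2 ^ j)
    where
    rearrange : ∀ k x → k * (2 * (2 * (2 * x))) + 1 ≡ 1 + k * x * 8
    rearrange = ℕSolver.solve-∀
  k*2^≡c*4 : k * 2 ^ (2 + j) ≡ c * 4
  k*2^≡c*4 = rearrange k (2 ^ j)
    where
    rearrange : ∀ k x → k * (2 * (2 * x)) ≡ k * x * 4
    rearrange = ℕSolver.solve-∀
  1<2^m : 1 < 2 ^ m
  1<2^m = ℕ.≤-<-trans 0<k k<2^m
  8<N : 8 < N
  8<N = begin-strict
    1 * 8      ≤⟨ ℕ.*-monoˡ-≤ 8 (ℕ.*-mono-≤ 0<k (ℕ.m^n>0 2 j)) ⟩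
    c * 8      <⟨ ℕ.n<1+n (c * 8) ⟩
    1 + c * 8  ≡⟨ N≡1+c*8 ⟨
    N          ∎
    where open ℕ.≤-Reasoning
  k%2≡1 = proj₁ (residues m k hyp)
  N%3≡2 = proj₁ (proj₂ (residues m k hyp))
  N%5≡±2 = proj₂ (proj₂ (residues m k hyp))

  to : Prime N → + N ∣ S (suc j) (V (+ 8) (+ 1) k)
  to N-prime = ≋0⇒∣ᵤ N-prime (S∘V≋0 N-prime {c} N≡1+c*8
    E.16^c≋1 (E.81^c≋-1 {N / 3} (division 3 N%3≡2))
    (E.625^c≋-1 {N / 5} (Sum.map (division 5) (division 5) N%5≡±2))
    -- The norm -6 of 3 + √15 is nonzero modulo `N`, because 6 < 8 < N.
    (λ -6≋0 → ℕ.<⇒≱ (ℕ.<-trans (ℕ.m<n+m 6 {2} (s≤s z≤n)) 8<N) (ℕ.∣⇒≤ (≋0⇒∣ᵤ N-prime -6≋0)))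
    k (suc j) k*2^≡c*4)
    where
    module E = EulerCriteria {c = c} N-prime N≡1+c*8
    division : ∀ d {r} .{{_ : NonZero d}} → N % d ≡ r → N ≡ r + N / d * d
    division d refl = m≡m%n+[m/n]*n N d

  2^m≤ : + N ∣ S (suc j) (V (+ 8) (+ 1) k) → ∀ p → Prime p → p ℕ.∣ N → 2 ^ m ≤ p
  2^m≤ N∣S p p-prime p∣N = 2^m≤1+p⇒2^m≤p {m = 2 + j} k%2≡1
    (nonTrivial⇒n>1 p {{prime⇒nonTrivial p-prime}}) k<2^m p∣N
    (S∘V≋0⇒2^≤1+p p-prime {proj₁ p-odd} (proj₂ p-odd)
      (prime∤15 p-prime p∣N N%3≡2 N%5≡±2 ∘ ≋0⇒∣ᵤ p-prime)
      -- The congruence says that `p` divides -2, which is impossible as `N` is odd.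
      (λ -1≋1 → p∤2 (ℤˢ.∣⇒∣ᵤ (∣- -1≋1)))
      k (suc j) (∣⇒≋0 (ℤˢ.∣ᵤ⇒∣ (ℕ.∣-trans p∣N N∣S))))
    where
    open Modular p
    p∤2 = prime∤2 p-prime {c = c} p∣N N≡1+c*8
    p-odd = odd-prime p-prime p∤2

  from : + N ∣ S (suc j) (V (+ 8) (+ 1) k) → Prime N
  from N∣S = no-small-prime-factor⇒prime N (2 ^ m)
    {{n>1⇒nonTrivial (ℕ.<-trans {1} {8} (s≤s (s≤s z≤n)) 8<N)}}
    -- This is where k < 2ᵐ bounds `N` by the square of 2ᵐ.
    (k*M+1<M*M k<2^m 1<2^m) (2^m≤ N∣S)
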